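{- Let $M\models REF$ be arbitrary and let $\mathcal{A}=\{D_i:i\in I\}$ be a set of $\emptyset$-definable subsets $D_i\subseteq M^{k_i}$ for various $k_i$. Then there is a subset $J\subseteq\omega$ such that $\mathcal{A}$ and $\{E_j:j\in J\}$ are $\emptyset$-definably equivalent.
   Context: $REF$ is the (incomplete) theory in the language $\mathcal{L}=\{E_n:n\in\omega\}$ of binary relation symbols asserting that each $E_n$ is an equivalence relation, that $E_{n+1}$ refines $E_n$ (i.e. $E_{n+1}(x,y)\to E_n(x,y)$) for each $n$, and that there is a function $\delta:\omega\to\{2,3,\dots,\infty\}$ specifying the number of classes into which $E_{n+1}$ partitions each $E_n$-class (i.e., each $E_n$-class is partitioned into exactly $\delta(n)$ $E_{n+1}$-classes if that number is finite, and into infinitely many otherwise). Infinite splitting is allowed. Two families $\mathcal{A}=\{D_i:i\in I\}$ and $\mathcal{A}'=\{D'_j:j\in J\}$ of subsets of finite powers of a non-empty set $M$ are $\emptyset$-definably equivalent if every $D'_j$ is $\emptyset$-definable (by a first-order formula with equality, without parameters) in the structure $(M,D_i:i\in I)$ and every $D_i$ is $\emptyset$-definable in the structure $(M,D'_j:j\in J)$. -}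

module Defs where

open import Level using (Level; _⊔_; suc)
open import Data.Empty.Polymorphic using (⊥)
open import Data.Fin.Base using (Fin)
open import Data.Nat.Base as ℕ using (ℕ)
open import Data.Product using (Σ; ∃; _×_; _,_; proj₁)
open import Data.Sum.Base using (_⊎_)
open import Data.Vec.Base using (Vec; []; _∷_; lookup; map)
open import Function.Base using (_∘_)
open import Function.Bundles using (_⇔_)
open import Function.Definitions using (Injective)
open import Relation.Binary.Core using (Rel; _⇒_)
open import Relation.Binary.PropositionalEquality.Core using (_≡_)
open import Relation.Binary.Structures using (IsEquivalence)
open import Relation.Unary using (Pred)

-- A family of subsets of finite powers of M.  The same data is a relational
-- structure on M, with one relation symbol per index.

record Family {a} (M : Set a) (i : Level) : Set (suc (a ⊔ i)) where
  field
    Index : Set i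
    arity : Index → ℕ
    rel   : (s : Index) → Pred (Vec M (arity s)) a

binaryFamily : ∀ {a i} {M : Set a} {K : Set i} → (K → Rel M a) → Family M i
binaryFamily {K = K} R = record
  { Index = K
  ; arity = λ _ → 2
  ; rel   = λ { k (x ∷ y ∷ []) → R k x y }
  }

-- First-order formulas with equality over the relation symbols I, with free
-- variables among Fin n.  A quantifier binds variable zero of its body.

data Formula {i} {I : Set i} (arity : I → ℕ) (n : ℕ) : Set i where
  falsum        : Formula arity n
  _≐_           : Fin n → Fin n → Formula arity n
  atom          : (s : I) → Vec (Fin n) (arity s) → Formula arity n
  _∧′_ _∨′_ _⇒′_ : Formula arity n → Formula arity n → Formula arity n
  ∀′ ∃′         : Formula arity (ℕ.suc n) → Formula arity n

module _ {a i} {M : Set a} (𝓕 : Family M i) where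
  open Family 𝓕

  Sat : ∀ {n} → Formula arity n → Pred (Vec M n) a
  Sat falsum      v = ⊥
  Sat (x ≐ y)     v = lookup v x ≡ lookup v y
  Sat (atom s xs) v = rel s (map (lookup v) xs)
  Sat (φ ∧′ ψ)    v = Sat φ v × Sat ψ v
  Sat (φ ∨′ ψ)    v = Sat φ v ⊎ Sat ψ v
  Sat (φ ⇒′ ψ)    v = Sat φ v → Sat ψ v
  Sat (∀′ φ)      v = ∀ x → Sat φ (x ∷ v)
  Sat (∃′ φ)      v = ∃ λ x → Sat φ (x ∷ v)

  Definable : ∀ {k} → Pred (Vec M k) a → Set (a ⊔ i)
  Definable {k} D = Σ (Formula arity k) λ φ → ∀ v → D v ⇔ Sat φ v

AllDefinable : ∀ {a i j} {M : Set a} → Family M i → Family M j → Set (a ⊔ i ⊔ j)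
AllDefinable 𝓕 𝓖 = ∀ s → Definable 𝓕 (Family.rel 𝓖 s)

DefinablyEquivalent : ∀ {a i j} {M : Set a} → Family M i → Family M j → Set (a ⊔ i ⊔ j)
DefinablyEquivalent 𝓐 𝓐′ = AllDefinable 𝓐 𝓐′ × AllDefinable 𝓐′ 𝓐

-- The set {2, 3, …, ∞} of possible splitting numbers.

data Splitting : Set where
  finite   : (k : ℕ) → 2 ℕ.≤ k → Splitting
  infinite : Splitting

module _ {a} {M : Set a} (E : ℕ → Rel M a) where

  -- k elements of the Eₙ-class of x lying in distinct Eₙ₊₁-classes.

  Representatives : ∀ n → M → (k : ℕ) → Pred (Fin k → M) a
  Representatives n x k f = (∀ i → E n x (f i)) × Injective _≡_ (E (ℕ.suc n)) f

  SplitsInto : Splitting → ℕ → M → Set a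
  SplitsInto (finite k _) n x =
    ∃ λ f → Representatives n x k f × (∀ y → E n x y → ∃ λ i → E (ℕ.suc n) (f i) y)
  SplitsInto infinite     n x = ∀ k → ∃ λ f → Representatives n x k f

  -- (M , E₀ , E₁ , …) is a model of REF.  As δ is existentially quantified in
  -- REF, it is a field here.

  record IsREF : Set a where
    field
      nonempty      : M
      isEquivalence : ∀ n → IsEquivalence (E n)
      refines       : ∀ n → E (ℕ.suc n) ⇒ E n
      δ             : ℕ → Splitting
      splits        : ∀ n x → SplitsInto (δ n) n x

  -- The family {Eⱼ : j ∈ J}, indexed by the elements of J.

  subfamily : ∀ {j} → Pred ℕ j → Family M j
  subfamily J = binaryFamily {K = ∃ J} (E ∘ proj₁)

{-# OPTIONS --safe #-}

-- A single D ∈ 𝓐 involves finitely many E_n, so it lives in a finite chain R 0 ⊇ R 1 ⊇ …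
-- of equivalence relations, from the total relation through R (n+1) = E_n to equality, in
-- which the number of R (l+1)-classes in an R l-class does not depend on the class.  By
-- back-and-forth, D depends only on which R l hold between the entries of a tuple.
--
-- Let J be the set of levels definable from 𝓐.  The levels outside J are dropped from the
-- description of D one at a time, starting with the finest.  Let p + 1 ∉ J be the next one
-- and q the last level of J met so far, so that D depends only on the levels ≤ p + 1 and
-- those of J that are ≥ q.  Say that b and c are related if swapping their R q-classes
-- preserves D.  This relation is definable from 𝓐 and contains R (p+1), and strictly so because
-- p + 1 ∉ J.  By homogeneity and conjugation of transpositions it then contains R p, and swaps
-- within R p-classes connect any two tuples that differ only at level p + 1.

module Submission where

open import Level using (0ℓ; _⊔_; Lift; lift; lower) renaming (suc to lsuc)
open import Axiom.ExcludedMiddle using (ExcludedMiddle)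
open import Data.Empty using (⊥-elim)
import Data.Empty.Polymorphic as ⊥ₚ
open import Data.Fin.Base as Fin using (Fin; zero; suc; _↑ˡ_; _↑ʳ_; toℕ; fromℕ<; inject≤)
open import Data.Fin.Properties
  using (injective⇒≤; inject≤-injective; toℕ-injective; toℕ-fromℕ<; toℕ<n)
open import Data.List.Base as List using (List; []; _∷_; upTo; allFin; cartesianProduct)
open import Data.List.Extrema.Nat using (max; xs≤max)
open import Data.List.Membership.Propositional using (_∈_)
open import Data.List.Membership.Propositional.Properties
  using (∈-allFin; ∈-upTo⁺; ∈-cartesianProduct⁺)
open import Data.List.Relation.Unary.All as All using (All)
open import Data.List.Relation.Unary.All.Properties using (++⁻ˡ; ++⁻ʳ)
open import Data.List.Relation.Unary.Any using (here; there)
open import Data.Nat.Base using (ℕ; zero; suc; _+_; _≤_; _<_; _≤′_; ≤′-reflexive; ≤′-step; z≤n; s≤s)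
import Data.Nat.Properties as ℕ
open import Data.Product using (∃; _×_; _,_; proj₁; proj₂)
open import Data.Product.Function.NonDependent.Propositional using (_×-⇔_)
open import Data.Sum.Base as Sum using (_⊎_; inj₁; inj₂)
open import Data.Sum.Function.Propositional using (_⊎-⇔_)
open import Data.Unit.Base using (tt)
open import Data.Unit.Polymorphic.Base using () renaming (⊤ to ⊤ₚ; tt to ttₚ)
open import Data.Vec.Base as Vec using (Vec; []; _∷_; lookup; map; take; drop; tabulate; replicate)
open import Data.Vec.Properties
  using (lookup-map; map-∘; map-cong; lookup-replicate; lookup∘tabulate; map-lookup-allFin)
open import Function.Base using (_∘_; id; _$_; _∋_)
open import Function.Bundles using (_⇔_; mk⇔; Equivalence)
open import Function.Definitions using (Injective)
open import Function.Properties.Equivalence using ()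
  renaming (refl to ⇔-refl; sym to ⇔-sym; trans to ⇔-trans)
open import Function.Related.TypeIsomorphisms using (→-cong-⇔)
open import Relation.Binary.Core using (Rel; _⇒_)
open import Relation.Binary.PropositionalEquality
  using (_≡_; refl; sym; trans; cong; cong₂; subst; subst₂)
import Relation.Binary.PropositionalEquality as ≡
open import Relation.Binary.Structures using (IsEquivalence)
open import Relation.Nullary using (Dec; yes; no; ¬_)
open import Relation.Nullary.Decidable using (map′; True; toWitness; fromWitness)
open import Relation.Unary using (Pred; U)
open import Defs

open Equivalence using (to; from)

-- Excluded middle, congruence of connectives, entries of vectors

excludedMiddle-lower : ∀ {a} b → ExcludedMiddle (a ⊔ b) → ExcludedMiddle a
excludedMiddle-lower b em {A} = map′ lower lift (em {Lift b A})

∀-cong-⇔ : ∀ {a b c} {A : Set a} {B : A → Set b} {C : A → Set c} →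
  (∀ x → B x ⇔ C x) → (∀ x → B x) ⇔ (∀ x → C x)
∀-cong-⇔ B⇔C = mk⇔ (λ h x → to (B⇔C x) (h x)) (λ h x → from (B⇔C x) (h x))

∃-cong-⇔ : ∀ {a b c} {A : Set a} {B : A → Set b} {C : A → Set c} →
  (∀ x → B x ⇔ C x) → ∃ B ⇔ ∃ C
∃-cong-⇔ B⇔C = mk⇔ (λ (x , h) → x , to (B⇔C x) h) (λ (x , h) → x , from (B⇔C x) h)

≡⇒⇔ : ∀ {a} {A B : Set a} → A ≡ B → A ⇔ B
≡⇒⇔ refl = ⇔-refl

lookup-take : ∀ {a} {A : Set a} k {n} (v : Vec A (k + n)) i → lookup (take k v) i ≡ lookup v (i ↑ˡ n)
lookup-take (suc k) (x ∷ v) zero    = refl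
lookup-take (suc k) (x ∷ v) (suc i) = lookup-take k v i

lookup-drop : ∀ {a} {A : Set a} k {n} (v : Vec A (k + n)) i → lookup (drop k v) i ≡ lookup v (k ↑ʳ i)
lookup-drop zero    v       i = refl
lookup-drop (suc k) (x ∷ v) i = lookup-drop k v i

pairs : ∀ {a} {M : Set a} → Rel M a → Pred (Vec M 2) a
pairs R v = R (lookup v zero) (lookup v (suc zero))

-- Definability

record Var {a} {M : Set a} {n} (f : Vec M n → M) : Set a where
  constructor var
  field
    index : Fin n
    value : ∀ v → f v ≡ lookup v index

-- A substitution of variables for variables, up to pointwise equality. Definability of `P` passes
-- to `P ∘ X` for such `X` by renaming.
record Selection {a} {M : Set a} {n k} (X : Vec M n → Vec M k) : Set a where
  constructor selection
  field
    indices : Fin k → Fin n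
    values  : ∀ v i → lookup (X v) i ≡ lookup v (indices i)

module _ {a} {M : Set a} where

  take-selection : ∀ k {n m} {X : Vec M m → Vec M (k + n)} → Selection X → Selection (take k ∘ X)
  take-selection k {n} {X = X} (selection ρ p) =
    selection (ρ ∘ (_↑ˡ n)) λ v i → trans (lookup-take k (X v) i) (p v _)

  drop-selection : ∀ k {n m} {X : Vec M m → Vec M (k + n)} → Selection X → Selection (drop k ∘ X)
  drop-selection k {n} {X = X} (selection ρ p) =
    selection (ρ ∘ (k ↑ʳ_)) λ v i → trans (lookup-drop k (X v) i) (p v _)

  id-selection : ∀ {n} → Selection {M = M} {n} id
  id-selection = selection id λ _ _ → refl

  lookup-var : ∀ {n k} {X : Vec M n → Vec M k} → Selection X → ∀ i → Var (λ v → lookup (X v) i)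
  lookup-var (selection ρ p) i = var (ρ i) λ v → p v i

rename : ∀ {i} {I : Set i} {ar : I → ℕ} {n m} → (Fin n → Fin m) → Formula ar n → Formula ar m
rename ρ falsum      = falsum
rename ρ (x ≐ y)     = ρ x ≐ ρ y
rename ρ (atom s xs) = atom s (map ρ xs)
rename ρ (φ ∧′ ψ)    = rename ρ φ ∧′ rename ρ ψ
rename ρ (φ ∨′ ψ)    = rename ρ φ ∨′ rename ρ ψ
rename ρ (φ ⇒′ ψ)    = rename ρ φ ⇒′ rename ρ ψ
rename ρ (∀′ φ)      = ∀′ (rename (Fin.lift 1 ρ) φ)
rename ρ (∃′ φ)      = ∃′ (rename (Fin.lift 1 ρ) φ)

module Definability {a i} {M : Set a} (𝓕 : Family M i) where
  open Family 𝓕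

  Sat-rename : ∀ {n m} (φ : Formula arity n) {ρ : Fin n → Fin m} {v : Vec M n} {w : Vec M m} →
    (∀ j → lookup v j ≡ lookup w (ρ j)) → Sat 𝓕 φ v ⇔ Sat 𝓕 (rename ρ φ) w
  Sat-rename falsum      p = ⇔-refl
  Sat-rename (x ≐ y)     p = mk⇔ (subst₂ _≡_ (p x) (p y)) (subst₂ _≡_ (sym (p x)) (sym (p y)))
  Sat-rename (atom s xs) {ρ} {v} {w} p =
    ≡⇒⇔ (cong (rel s) (trans (map-cong p xs) (map-∘ (lookup w) ρ xs)))
  Sat-rename (φ ∧′ ψ) p = Sat-rename φ p ×-⇔ Sat-rename ψ p
  Sat-rename (φ ∨′ ψ) p = Sat-rename φ p ⊎-⇔ Sat-rename ψ p
  Sat-rename (φ ⇒′ ψ) p = →-cong-⇔ (Sat-rename φ p) (Sat-rename ψ p)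
  Sat-rename (∀′ φ) p = ∀-cong-⇔ λ x → Sat-rename φ λ { zero → refl ; (suc j) → p j }
  Sat-rename (∃′ φ) p = ∃-cong-⇔ λ x → Sat-rename φ λ { zero → refl ; (suc j) → p j }

  module _ {n} {P Q : Pred (Vec M n) a} where

    definable-resp-⇔ : (∀ v → P v ⇔ Q v) → Definable 𝓕 P → Definable 𝓕 Q
    definable-resp-⇔ P⇔Q (φ , p) = φ , λ v → ⇔-trans (⇔-sym (P⇔Q v)) (p v)

    definable-× : Definable 𝓕 P → Definable 𝓕 Q → Definable 𝓕 (λ v → P v × Q v)
    definable-× (φ , p) (ψ , q) = φ ∧′ ψ , λ v → p v ×-⇔ q v

    definable-⊎ : Definable 𝓕 P → Definable 𝓕 Q → Definable 𝓕 (λ v → P v ⊎ Q v)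
    definable-⊎ (φ , p) (ψ , q) = φ ∨′ ψ , λ v → p v ⊎-⇔ q v

    definable-→ : Definable 𝓕 P → Definable 𝓕 Q → Definable 𝓕 (λ v → P v → Q v)
    definable-→ (φ , p) (ψ , q) = φ ⇒′ ψ , λ v → →-cong-⇔ (p v) (q v)

  module _ {n} {P : Pred (Vec M n) a} where

    definable-empty : (∀ v → ¬ P v) → Definable 𝓕 P
    definable-empty ¬P = falsum , λ v → mk⇔ (⊥-elim ∘ ¬P v) ⊥ₚ.⊥-elim

    definable-full : (∀ v → P v) → Definable 𝓕 P
    definable-full p = falsum ⇒′ falsum , λ v → mk⇔ (λ _ → id) (λ _ → p v)

    definable-¬ : Definable 𝓕 P → Definable 𝓕 (λ v → ¬ P v)
    definable-¬ (φ , p) = φ ⇒′ falsum , λ v →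
      mk⇔ (λ ¬Pv → ⊥-elim ∘ ¬Pv ∘ from (p v)) (λ h → ⊥ₚ.⊥-elim ∘ h ∘ to (p v))

    definable-select : ∀ {m} {X : Vec M m → Vec M n} → Selection X →
      Definable 𝓕 P → Definable 𝓕 (P ∘ X)
    definable-select {X = X} (selection ρ s) (φ , p) =
      rename ρ φ , λ v → ⇔-trans (p (X v)) (Sat-rename φ (s v))

  definable-⇔ : ∀ {n} {P Q : Pred (Vec M n) a} →
    Definable 𝓕 P → Definable 𝓕 Q → Definable 𝓕 (λ v → P v ⇔ Q v)
  definable-⇔ p q = definable-resp-⇔
    (λ v → mk⇔ (λ (f , g) → mk⇔ f g) (λ e → to e , from e))
    (definable-× (definable-→ p q) (definable-→ q p))

  definable-pairs : ∀ (R : Rel M a) {n} {f g : Vec M n → M} → Definable 𝓕 (pairs R) →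
    Var f → Var g → Definable 𝓕 (λ v → R (f v) (g v))
  definable-pairs R {f = f} {g} r (var x p) (var y q) =
    definable-select {X = λ v → f v ∷ g v ∷ []}
      (selection (lookup (x ∷ y ∷ [])) λ { v zero → p v ; v (suc zero) → q v }) r

  definable-≡ : Definable 𝓕 (pairs _≡_)
  definable-≡ = zero ≐ suc zero , λ _ → ⇔-refl

  -- A quantifier binds variable zero, so the head of the block is quantified innermost and the
  -- induction goes on with the tail.
  definable-∀Vec : ∀ k {n} (P : Vec M k → Pred (Vec M n) a) →
    Definable 𝓕 (λ v → P (take k v) (drop k v)) → Definable 𝓕 (λ v → ∀ xs → P xs v)
  definable-∀Vec zero    P p = definable-resp-⇔ (λ v → mk⇔ (λ { h [] → h }) (λ h → h [])) p
  definable-∀Vec (suc k) P (φ , p) = definable-resp-⇔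
    (λ v → mk⇔ (λ { h (x ∷ xs) → h xs x }) (λ h xs x → h (x ∷ xs)))
    (definable-∀Vec k (λ xs v → ∀ x → P (x ∷ xs) v) (∀′ φ , λ v → ∀-cong-⇔ λ x → p (x ∷ v)))

  definable-guard : ∀ {n} {A : Set} {P : Pred (Vec M n) a} → Dec A →
    (A → Definable 𝓕 P) → Definable 𝓕 (λ v → A → P v)
  definable-guard (yes x) p = definable-resp-⇔ (λ v → mk⇔ (λ h _ → h) (λ h → h x)) (p x)
  definable-guard (no ¬x) p = definable-full λ v x → ⊥-elim (¬x x)

  definable-All : ∀ {X : Set} {n} (xs : List X) {P : X → Pred (Vec M n) a} →
    (∀ x → Definable 𝓕 (P x)) → Definable 𝓕 (λ v → ∀ x → x ∈ xs → P x v)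
  definable-All []       p = definable-full λ _ _ ()
  definable-All (x ∷ xs) p = definable-resp-⇔
    (λ v → mk⇔ (λ { (h , _) _ (here refl) → h ; (_ , h) y (there y∈) → h y y∈ })
               (λ h → h x (here refl) , λ y → h y ∘ there))
    (definable-× (p x) (definable-All xs p))

  definable-∀Fin : ∀ {m n} {P : Fin m → Pred (Vec M n) a} →
    (∀ j → Definable 𝓕 (P j)) → Definable 𝓕 (λ v → ∀ j → P j v)
  definable-∀Fin {m} p = definable-resp-⇔
    (λ v → mk⇔ (λ h j → h j (∈-allFin j)) (λ h j _ → h j)) (definable-All (allFin m) p)

  -- A disjunctive normal form, built by splitting on `P x`. Once no condition is left, `D` holds
  -- everywhere or nowhere.
  definable-finitelyDetermined : ExcludedMiddle a →
    ∀ {X : Set} {n} (xs : List X) (P : X → Pred (Vec M n) a) {D : Pred (Vec M n) a} →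
    (∀ x → Definable 𝓕 (P x)) →
    (∀ {v w} → (∀ x → x ∈ xs → P x v ⇔ P x w) → D v → D w) → Definable 𝓕 D
  definable-finitelyDetermined em [] P {D} p inv with em {∃ D}
  ... | yes (v , d) = definable-full λ w → inv {v} (λ _ ()) d
  ... | no ¬d       = definable-empty λ w d → ¬d (w , d)
  definable-finitelyDetermined em (x ∷ xs) P {D} p inv = definable-resp-⇔ equiv
    (definable-⊎ (definable-× (p x) (rest (P x)))
                 (definable-× (definable-¬ (p x)) (rest (¬_ ∘ P x))))
    where
    Like : (_ _ : Vec M _) → Set a
    Like v w = ∀ y → y ∈ xs → P y v ⇔ P y w
    -- `D` is cut down to `B` and then saturated under agreement on `xs`, so that the induction
    -- hypothesis applies.
    Rest : Pred (Vec M _) a → Pred (Vec M _) a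
    Rest B w = ∃ λ v → B v × D v × Like v w
    rest : ∀ B → Definable 𝓕 (Rest B)
    rest B = definable-finitelyDetermined em xs P p
      λ { v∼w (u , b , d , u∼v) → u , b , d , λ y y∈ → ⇔-trans (u∼v y y∈) (v∼w y y∈) }
    extend : ∀ {v w} → P x v ⇔ P x w → Like v w → D v → D w
    extend e v∼w = inv λ { _ (here refl) → e ; y (there y∈) → v∼w y y∈ }
    equiv : ∀ w → (P x w × Rest (P x) w ⊎ ¬ P x w × Rest (¬_ ∘ P x) w) ⇔ D w
    equiv w = mk⇔
      (λ { (inj₁ (q , v , b , d , v∼w)) → extend (mk⇔ (λ _ → q) (λ _ → b)) v∼w d
         ; (inj₂ (q , v , b , d , v∼w)) → extend (mk⇔ (⊥-elim ∘ b) (⊥-elim ∘ q)) v∼w d })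
      (λ d → dec d em)
      where
      dec : D w → Dec (P x w) → _
      dec d (yes q) = inj₁ (q , w , q , d , λ _ _ → ⇔-refl)
      dec d (no ¬q) = inj₂ (¬q , w , ¬q , d , λ _ _ → ⇔-refl)

-- Uniform chains of equivalence relations

module _ {a} {M : Set a} where

  HasReps : Rel M a → Rel M a → ℕ → Pred M a
  HasReps P Q k x = ∃ λ (f : Fin k → M) → (∀ i → P x (f i)) × Injective _≡_ Q f

  -- Only lower bounds on the number of classes are compared, one finite `k` at a time, which treats
  -- finite and infinite splitting alike.
  Uniform : Rel M a → Rel M a → Set a
  Uniform P Q = ∀ {k x y} → HasReps P Q k x → HasReps P Q k y

  HasReps-≤ : ∀ (P Q : Rel M a) {k m x} → k ≤ m → HasReps P Q m x → HasReps P Q k x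
  HasReps-≤ P Q k≤m (f , xf , f-inj) =
    (λ i → f (inject≤ i k≤m)) , (λ i → xf (inject≤ i k≤m)) , inject≤-injective k≤m k≤m _ _ ∘ f-inj

  reps⇒gap : ExcludedMiddle a → ∀ (P : Rel M a) {Q} → IsEquivalence Q →
    ∀ {x} → HasReps P Q 2 x → ∃ λ y → P x y × ¬ Q x y
  reps⇒gap em P {Q} eqQ {x} (f , xf , f-inj) with em {Q x (f zero)}
  ... | no ¬q = f zero , xf zero , ¬q
  ... | yes q = f (suc zero) , xf (suc zero) , λ q′ → 0≢1 (f-inj (Eq.trans (Eq.sym q) q′))
    where
    module Eq = IsEquivalence eqQ
    0≢1 : ¬ (Fin 2 ∋ zero) ≡ suc zero
    0≢1 ()

  IsEquivalence-cong : ∀ {_≈_ : Rel M a} → IsEquivalence _≈_ →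
    ∀ {x x′ y y′} → x ≈ x′ → y ≈ y′ → x ≈ y ⇔ x′ ≈ y′
  IsEquivalence-cong eq p q =
    mk⇔ (λ r → Eq.trans (Eq.sym p) (Eq.trans r q)) (λ r → Eq.trans p (Eq.trans r (Eq.sym q)))
    where module Eq = IsEquivalence eq

  -- If no class of Q inside the P-class of c were free, then w would map representatives
  -- of these classes injectively to indices.  Together with x, the entries of v at those
  -- indices are one more representatives, so their number could be raised beyond n.
  one-point : ExcludedMiddle a → {P Q : Rel M a} → IsEquivalence P → IsEquivalence Q → Q ⇒ P →
    Uniform P Q → ∀ {n} (K : Pred (Fin n) 0ℓ) {v w : Fin n → M} {x c} →
    (∀ {i j} → K i → K j → Q (v i) (v j) ⇔ Q (w i) (w j)) →
    (∀ {i} → K i → P x (v i) ⇔ P c (w i)) →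
    ∃ λ c′ → P c c′ × (∀ {i} → K i → Q x (v i) ⇔ Q c′ (w i))
  one-point em {P} {Q} eqP eqQ Q⇒P uni {n} K {v} {w} {x} {c} vw xc
    with em {∃ λ i → K i × Q x (v i)}
  ... | yes (i , Ki , xvi) = w i , to (xc Ki) (Q⇒P xvi) ,
        λ Kj → ⇔-trans (IsEquivalence-cong eqQ xvi (IsEquivalence.refl eqQ)) (vw Ki Kj)
  ... | no x∉v with em {∃ λ c′ → P c c′ × (∀ {i} → K i → ¬ Q c′ (w i))}
  ... | yes (c′ , cc′ , c′∉w) = c′ , cc′ ,
        λ Ki → mk⇔ (λ q → ⊥-elim (x∉v (_ , Ki , q))) (⊥-elim ∘ c′∉w Ki)
  ... | no covered = ⊥-elim (ℕ.1+n≰n (injective⇒≤ (λ {s} {t} → g-injective {s} {t})))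
    where
    module P = IsEquivalence eqP
    module Q = IsEquivalence eqQ
    cover : ∀ {c′} → P c c′ → ∃ λ i → K i × Q c′ (w i)
    cover {c′} cc′ with em {∃ λ i → K i × Q c′ (w i)}
    ... | yes found = found
    ... | no ¬found = ⊥-elim (covered (c′ , cc′ , λ Ki q → ¬found (_ , Ki , q)))
    reps : ∀ r → ∃ λ (g : Fin r → Fin n) →
      (∀ s → K (g s) × P x (v (g s))) × Injective _≡_ Q (v ∘ g)
    reps zero    = (λ ()) , (λ ()) , λ {}
    reps (suc r) = g′ , (λ s → Kg′ s , from (xc (Kg′ s)) (P.trans (cf s) (Q⇒P (fw s)))) ,
      λ {s} {t} q → f-inj (Q.trans (fw s) (Q.trans (to (vw (Kg′ s) (Kg′ t)) q) (Q.sym (fw t))))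
      where
      old = reps r
      g = proj₁ old
      Kg = proj₁ (proj₂ old)
      extended : HasReps P Q (suc r) x
      extended = (λ { zero → x ; (suc s) → v (g s) }) ,
        (λ { zero → P.refl ; (suc s) → proj₂ (Kg s) }) ,
        λ { {zero} {zero} _ → refl
          ; {zero} {suc t} q → ⊥-elim (x∉v (g t , proj₁ (Kg t) , q))
          ; {suc s} {zero} q → ⊥-elim (x∉v (g s , proj₁ (Kg s) , Q.sym q))
          ; {suc s} {suc t} q → cong suc (proj₂ (proj₂ old) q) }
      moved = uni {y = c} extended
      f = proj₁ moved
      cf = proj₁ (proj₂ moved)
      f-inj = λ {s} {t} → proj₂ (proj₂ moved) {s} {t}
      found : ∀ s → ∃ λ i → K i × Q (f s) (w i)
      found s = cover (cf s)
      g′ : Fin (suc r) → Fin n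
      g′ s = proj₁ (found s)
      Kg′ : ∀ s → K (g′ s)
      Kg′ s = proj₁ (proj₂ (found s))
      fw : ∀ s → Q (f s) (w (g′ s))
      fw s = proj₂ (proj₂ (found s))
    g-injective : Injective _≡_ _≡_ (proj₁ (reps (suc n)))
    g-injective gs≡gt = proj₂ (proj₂ (reps (suc n))) (Q.reflexive (cong v gs≡gt))

-- Finite chains and back-and-forth

atoms : ∀ {i} {I : Set i} {ar : I → ℕ} {n} → Formula ar n → List I
atoms falsum     = []
atoms (_ ≐ _)    = []
atoms (atom s _) = s ∷ []
atoms (φ ∧′ ψ)   = atoms φ List.++ atoms ψ
atoms (φ ∨′ ψ)   = atoms φ List.++ atoms ψ
atoms (φ ⇒′ ψ)   = atoms φ List.++ atoms ψ
atoms (∀′ φ)     = atoms φ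
atoms (∃′ φ)     = atoms φ

record Chain {a} (M : Set a) : Set (lsuc a) where
  field
    R             : ℕ → Rel M a
    height        : ℕ
    isEquivalence : ∀ l → IsEquivalence (R l)
    refines       : ∀ l → R (suc l) ⇒ R l
    coarsest      : ∀ x y → R 0 x y
    finest        : ∀ {l} → height ≤ l → R l ⇒ _≡_
    uniform       : ∀ l → Uniform (R l) (R (suc l))

  R-refl : ∀ l {x} → R l x x
  R-refl l = IsEquivalence.refl (isEquivalence l)

  R-sym : ∀ l {x y} → R l x y → R l y x
  R-sym l = IsEquivalence.sym (isEquivalence l)

  R-trans : ∀ l {x y z} → R l x y → R l y z → R l x z
  R-trans l = IsEquivalence.trans (isEquivalence l)

  R-cong : ∀ l {x x′ y y′} → R l x x′ → R l y y′ → R l x y ⇔ R l x′ y′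
  R-cong l = IsEquivalence-cong (isEquivalence l)

  antitone : ∀ {l m} → l ≤ m → R m ⇒ R l
  antitone {l} l≤m with ℕ.≤⇒≤′ l≤m
  ... | l≤′m = go l≤′m
    where
    go : ∀ {m} → l ≤′ m → R m ⇒ R l
    go (≤′-reflexive refl) = id
    go (≤′-step l≤′m)      = go l≤′m ∘ refines _

  finest-⇔ : ∀ {l m} → height ≤ l → height ≤ m → ∀ {x y} → R l x y ⇔ R m x y
  finest-⇔ {l} {m} h≤l h≤m =
    mk⇔ (λ r → subst (R m _) (finest h≤l r) (R-refl m))
        (λ r → subst (R l _) (finest h≤m r) (R-refl l))

  height-⇔ : ∀ {x y} → R height x y ⇔ x ≡ y
  height-⇔ = mk⇔ (finest ℕ.≤-refl) (λ { refl → R-refl height })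

  -- For `S = U` this is equality of quantifier-free types, since level `height` is equality.
  record Agree (S : Pred ℕ 0ℓ) {n} (v w : Vec M n) : Set a where
    constructor agree
    field at : ∀ {l} → S l → ∀ i j →
            R l (lookup v i) (lookup v j) ⇔ R l (lookup w i) (lookup w j)
  open Agree public

  Agree-⊆ : ∀ {S T n} {v w : Vec M n} → (∀ {l} → T l → S l) → Agree S v w → Agree T v w
  Agree-⊆ T⊆S v∼w = agree λ t → at v∼w (T⊆S t)

  Agree-sym : ∀ {S n} {v w : Vec M n} → Agree S v w → Agree S w v
  Agree-sym v∼w = agree λ s i j → ⇔-sym (at v∼w s i j)

  Agree-trans : ∀ {S n} {u v w : Vec M n} → Agree S u v → Agree S v w → Agree S u w
  Agree-trans u∼v v∼w = agree λ s i j → ⇔-trans (at u∼v s i j) (at v∼w s i j)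

  Agree-∷ : ∀ {S n x y} {v w : Vec M n} → Agree S v w →
    (∀ {l} → S l → ∀ i → R l x (lookup v i) ⇔ R l y (lookup w i)) → Agree S (x ∷ v) (y ∷ w)
  Agree-∷ {S} {x = x} {y} {v} {w} v∼w xy = agree go
    where
    go : ∀ {l} → S l → ∀ i j →
      R l (lookup (x ∷ v) i) (lookup (x ∷ v) j) ⇔ R l (lookup (y ∷ w) i) (lookup (y ∷ w) j)
    go {l} s zero    zero    = mk⇔ (λ _ → R-refl l) (λ _ → R-refl l)
    go {l} s zero    (suc j) = xy s j
    go {l} s (suc i) zero    =
      mk⇔ (R-sym l ∘ to (xy s i) ∘ R-sym l) (R-sym l ∘ from (xy s i) ∘ R-sym l)
    go {l} s (suc i) (suc j) = at v∼w s i j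

  Invariant : Pred ℕ 0ℓ → ∀ {n} → Pred (Vec M n) a → Set a
  Invariant S P = ∀ {v w} → Agree S v w → P v → P w

  module _ (em : ExcludedMiddle a) where

    -- The point is found level by level: `one-point` picks a class inside the one chosen before,
    -- until the levels become equality.
    extension : ∀ q {n} {v w : Vec M n} {x c} → Agree (q ≤_) v w →
      (∀ i → R q x (lookup v i) ⇔ R q c (lookup w i)) →
      ∃ λ y → R q c y × (∀ {l} → q ≤ l → ∀ i → R l x (lookup v i) ⇔ R l y (lookup w i))
    extension q = go height q (ℕ.m≤m+n height q)
      where
      go : ∀ d q → height ≤ d + q → ∀ {n} {v w : Vec M n} {x c} → Agree (q ≤_) v w →
        (∀ i → R q x (lookup v i) ⇔ R q c (lookup w i)) →
        ∃ λ y → R q c y × (∀ {l} → q ≤ l → ∀ i → R l x (lookup v i) ⇔ R l y (lookup w i))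
      -- All levels from `q` on are equality, so `c` itself serves.
      go zero q h≤q {c = c} v∼w xc = c , R-refl q , λ q≤l i →
        let h≤l = ℕ.≤-trans h≤q q≤l in
        ⇔-trans (finest-⇔ h≤l h≤q) (⇔-trans (xc i) (finest-⇔ h≤q h≤l))
      go (suc d) q h≤ {v = v} {w} {x} {c} v∼w xc
        with c′ , cc′ , xc′ ← one-point em (isEquivalence q) (isEquivalence (suc q)) (refines q)
                                (uniform q) U (λ {i} {j} _ _ → at v∼w (ℕ.n≤1+n q) i j) (λ {i} _ → xc i)
        with y , c′y , xy ← go d (suc q) (subst (height ≤_) (sym (ℕ.+-suc d q)) h≤)
                              (Agree-⊆ ℕ.<⇒≤ v∼w) (λ i → xc′ {i} tt)
        = y , cy , λ q≤l i → level q≤l i (ℕ.m≤n⇒m<n∨m≡n q≤l)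
        where
        cy : R q c y
        cy = R-trans q cc′ (refines q c′y)
        level : ∀ {l} → q ≤ l → ∀ i → q < l ⊎ q ≡ l → R l x (lookup v i) ⇔ R l y (lookup w i)
        level _ i (inj₁ q<l)  = xy q<l i
        level _ i (inj₂ refl) = ⇔-trans (xc i) (R-cong q cy (R-refl q))

    -- The tuple `c` prescribes the `R q`-classes, and the finer pattern of `v` is realised inside
    -- them one entry at a time.
    transport : ∀ q {n} (v c : Vec M n) →
      (∀ i j → R q (lookup v i) (lookup v j) ⇔ R q (lookup c i) (lookup c j)) →
      ∃ λ w → (∀ i → R q (lookup c i) (lookup w i)) × Agree (q ≤_) v w
    transport q []      []      _  = [] , (λ ()) , agree λ _ ()
    transport q (x ∷ v) (c ∷ cs) vc
      with w , cw , v∼w ← transport q v cs (λ i j → vc (suc i) (suc j))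
      with y , cy , xy ← extension q {x = x} {c} v∼w
                           (λ i → ⇔-trans (vc zero (suc i)) (R-cong q (R-refl q) (cw i)))
      = y ∷ w , (λ { zero → cy ; (suc i) → cw i }) , Agree-∷ v∼w xy

    -- The representatives all lie in one `R p`-class, so `transport` carries them to the class of
    -- the constant tuple `y`. Agreement at level `q` keeps them apart.
    uniform-≤ : ∀ {p q} → p ≤ q → Uniform (R p) (R q)
    uniform-≤ {p} {q} p≤q {k} {x} {y} (f , xf , f-inj)
      with w , yw , f∼w ← transport p (tabulate f) (replicate k y) (λ i j → mk⇔
             (λ _ → subst₂ (R p) (sym (lookup-replicate i y)) (sym (lookup-replicate j y)) (R-refl p))
             (λ _ → subst₂ (R p) (sym (lookup∘tabulate f i)) (sym (lookup∘tabulate f j))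
                      (R-trans p (R-sym p (xf i)) (xf j))))
      = lookup w , (λ i → subst (λ z → R p z (lookup w i)) (lookup-replicate i y) (yw i)) ,
        λ {i} {j} r → f-inj (subst₂ (R q) (lookup∘tabulate f i) (lookup∘tabulate f j)
                               (from (at f∼w p≤q i j) r))

    extend : ∀ {n} {v w : Vec M n} → Agree U v w → ∀ x → ∃ λ y → Agree U (x ∷ v) (y ∷ w)
    extend v∼w x =
      -- Level 0 is total, so any point may serve as the prescribed one.
      let y , _ , xy = extension 0 {x = x} {x} (Agree-⊆ (λ _ → tt) v∼w)
                     (λ _ → mk⇔ (λ _ → coarsest _ _) (λ _ → coarsest _ _))
      in y , Agree-∷ v∼w (λ _ → xy z≤n)

    -- Back-and-forth; this stands in for quantifier elimination.
    Sat-invariant : ∀ {i} (𝓕 : Family M i) (let open Family 𝓕) {n} (φ : Formula arity n) →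
      All (λ s → Invariant U (rel s)) (atoms φ) → Invariant U (Sat 𝓕 φ)
    Sat-invariant 𝓕 falsum      inv v∼w = id
    Sat-invariant 𝓕 (x ≐ y)     inv v∼w = to (⇔-trans (⇔-sym height-⇔)
      (⇔-trans (at v∼w {height} tt x y) height-⇔))
    Sat-invariant 𝓕 (atom s xs) (inv All.∷ _) {v} {w} v∼w = inv $ agree λ {l} _ i j →
      subst₂ (λ A B → A ⇔ B)
        (cong₂ (R l) (sym (lookup-map i (lookup v) xs)) (sym (lookup-map j (lookup v) xs)))
        (cong₂ (R l) (sym (lookup-map i (lookup w) xs)) (sym (lookup-map j (lookup w) xs)))
        (at v∼w tt (lookup xs i) (lookup xs j))
    Sat-invariant 𝓕 (φ ∧′ ψ) inv v∼w (p , q) =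
      Sat-invariant 𝓕 φ (++⁻ˡ (atoms φ) inv) v∼w p , Sat-invariant 𝓕 ψ (++⁻ʳ (atoms φ) inv) v∼w q
    Sat-invariant 𝓕 (φ ∨′ ψ) inv v∼w =
      Sum.map (Sat-invariant 𝓕 φ (++⁻ˡ (atoms φ) inv) v∼w)
              (Sat-invariant 𝓕 ψ (++⁻ʳ (atoms φ) inv) v∼w)
    Sat-invariant 𝓕 (φ ⇒′ ψ) inv v∼w h =
      Sat-invariant 𝓕 ψ (++⁻ʳ (atoms φ) inv) v∼w ∘ h ∘
      Sat-invariant 𝓕 φ (++⁻ˡ (atoms φ) inv) (Agree-sym v∼w)
    Sat-invariant 𝓕 (∀′ φ) inv v∼w h y =
      let x , x∷v∼y∷w = extend (Agree-sym v∼w) y in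
      Sat-invariant 𝓕 φ inv (Agree-sym x∷v∼y∷w) (h x)
    Sat-invariant 𝓕 (∃′ φ) inv v∼w (x , h) =
      let y , x∷v∼y∷w = extend v∼w x in y , Sat-invariant 𝓕 φ inv x∷v∼y∷w h

-- Dropping one level

module _ {a} (em : ExcludedMiddle a) {M : Set a} (C : Chain M) where
  open Chain C

  dec₀ : ExcludedMiddle 0ℓ
  dec₀ = excludedMiddle-lower a em

  Agree-finest : ∀ {n} {v w : Vec M n} → Agree (_≤ height) v w → Agree U v w
  Agree-finest v∼w = agree λ {l} _ i j → level i j (ℕ.≤-total l height)
    where
    level : ∀ {l} i j → l ≤ height ⊎ height ≤ l → _
    level i j (inj₁ l≤h) = at v∼w l≤h i j
    level i j (inj₂ h≤l) = ⇔-trans (finest-⇔ h≤l ℕ.≤-refl)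
      (⇔-trans (at v∼w ℕ.≤-refl i j) (finest-⇔ ℕ.≤-refl h≤l))

  module _ {i} (𝓕 : Family M i) {S : Pred ℕ 0ℓ} (S≤h : ∀ {l} → S l → l ≤ height)
           (S-definable : ∀ {l} → S l → Definable 𝓕 (pairs (R l))) where
    open Definability 𝓕

    definable-Agree : ∀ {n k} {X Y : Vec M n → Vec M k} → Selection X → Selection Y →
      Definable 𝓕 (λ v → Agree S (X v) (Y v))
    definable-Agree sX sY = definable-resp-⇔
      (λ v → mk⇔ (λ h → agree λ {l} s → h l (∈-upTo⁺ (s≤s (S≤h s))) s) (λ h l _ s → at h s))
      (definable-All (upTo (suc height)) λ l → definable-guard dec₀ λ s →
        definable-∀Fin λ i → definable-∀Fin λ j → definable-⇔
          (definable-pairs (R _) (S-definable s) (lookup-var sX i) (lookup-var sX j))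
          (definable-pairs (R _) (S-definable s) (lookup-var sY i) (lookup-var sY j)))

    -- Membership in `D` depends on finitely many conditions `R l` between two entries. The guard
    -- `S l` makes those at other levels trivially true.
    definable-Invariant : ∀ {n} {D : Pred (Vec M n) a} → Invariant S D → Definable 𝓕 D
    definable-Invariant {n} inv = definable-finitelyDetermined em
      (cartesianProduct (upTo (suc height)) (cartesianProduct (allFin n) (allFin n)))
      (λ (l , i , j) v → S l → R l (lookup v i) (lookup v j))
      (λ (l , i , j) → definable-guard dec₀ λ s →
        definable-pairs (R _) (S-definable s) (lookup-var id-selection i) (lookup-var id-selection j))
      (λ h → inv (agree λ {l} s i j →
        let e = h (l , i , j) (∈-cartesianProduct⁺ (∈-upTo⁺ (s≤s (S≤h s)))
                                 (∈-cartesianProduct⁺ (∈-allFin i) (∈-allFin j)))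
        in mk⇔ (λ r → to e (λ _ → r) s) (λ r → from e (λ _ → r) s)))

  first-gap : ∀ p {x y} → ¬ R p x y → ∃ λ l → l < p × R l x y × ¬ R (suc l) x y
  first-gap zero    ¬r = ⊥-elim (¬r (coarsest _ _))
  first-gap (suc p) {x} {y} ¬r with em {R p x y}
  ... | yes r  = p , ℕ.≤-refl , r , ¬r
  ... | no ¬r′ = let l , l<p , gap = first-gap p ¬r′ in l , ℕ.m<n⇒m<1+n l<p , gap

  -- The points `x` and `y` are two representatives, which uniformity moves to the class of `z`.
  gap-everywhere : ∀ {l x y} → R l x y → ¬ R (suc l) x y → ∀ z → ∃ λ u → R l z u × ¬ R (suc l) z u
  gap-everywhere {l} {x} {y} r ¬r z = reps⇒gap em (R l) (isEquivalence (suc l)) (uniform l {2} {x}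
    ( (λ { zero → x ; (suc _) → y }) , (λ { zero → R-refl l ; (suc _) → r })
    , λ { {zero} {zero} _ → refl ; {suc zero} {suc zero} _ → refl
        ; {zero} {suc _} s → ⊥-elim (¬r s) ; {suc _} {zero} s → ⊥-elim (¬r (R-sym (suc l) s)) }))

  -- Transpositions of classes

  module Swap (q : ℕ) where

    -- The graph of the transposition of the R q-classes of b and c, up to R q.
    SwapsTo : (b c u w : M) → Set a
    SwapsTo b c u w =
      R q u b × R q c w ⊎ ¬ R q u b × R q u c × R q b w ⊎ ¬ R q u b × ¬ R q u c × R q u w

    module _ {b c : M} where

      at-left : ∀ {u w} → R q u b → SwapsTo b c u w → R q c w
      at-left ub (inj₁ (_ , cw))         = cw
      at-left ub (inj₂ (inj₁ (¬ub , _))) = ⊥-elim (¬ub ub)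
      at-left ub (inj₂ (inj₂ (¬ub , _))) = ⊥-elim (¬ub ub)

      at-right : ∀ {u w} → ¬ R q u b → R q u c → SwapsTo b c u w → R q b w
      at-right ¬ub uc (inj₁ (ub , _))                 = ⊥-elim (¬ub ub)
      at-right ¬ub uc (inj₂ (inj₁ (_ , _ , bw)))      = bw
      at-right ¬ub uc (inj₂ (inj₂ (_ , ¬uc , _)))     = ⊥-elim (¬uc uc)

      elsewhere : ∀ {u w} → ¬ R q u b → ¬ R q u c → SwapsTo b c u w → R q u w
      elsewhere ¬ub ¬uc (inj₁ (ub , _))             = ⊥-elim (¬ub ub)
      elsewhere ¬ub ¬uc (inj₂ (inj₁ (_ , uc , _)))  = ⊥-elim (¬uc uc)
      elsewhere ¬ub ¬uc (inj₂ (inj₂ (_ , _ , uw)))  = uw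

      swap : ∀ u → ∃ (SwapsTo b c u)
      swap u with em {R q u b} | em {R q u c}
      ... | yes ub | _      = c , inj₁ (ub , R-refl q)
      ... | no ¬ub | yes uc = b , inj₂ (inj₁ (¬ub , uc , R-refl q))
      ... | no ¬ub | no ¬uc = u , inj₂ (inj₂ (¬ub , ¬uc , R-refl q))

      functional : ∀ {u u′ w w′} → R q u u′ → SwapsTo b c u w → SwapsTo b c u′ w′ → R q w w′
      functional uu′ (inj₁ (ub , cw)) s′ =
        R-trans q (R-sym q cw) (at-left (R-trans q (R-sym q uu′) ub) s′)
      functional uu′ (inj₂ (inj₁ (¬ub , uc , bw))) s′ =
        R-trans q (R-sym q bw) (at-right (¬ub ∘ R-trans q uu′) (R-trans q (R-sym q uu′) uc) s′)
      functional uu′ (inj₂ (inj₂ (¬ub , ¬uc , uw))) s′ = R-trans q (R-sym q uw)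
        (R-trans q uu′ (elsewhere (¬ub ∘ R-trans q uu′) (¬uc ∘ R-trans q uu′) s′))

      SwapsTo-sym : ∀ {u w} → SwapsTo b c u w → SwapsTo b c w u
      SwapsTo-sym {w = w} (inj₁ (ub , cw)) with em {R q w b}
      -- Here `b` and `c` lie in the same `R q`-class and the transposition is trivial.
      ... | yes wb = inj₁ (wb , R-trans q cw (R-trans q wb (R-sym q ub)))
      ... | no ¬wb = inj₂ (inj₁ (¬wb , R-sym q cw , R-sym q ub))
      SwapsTo-sym (inj₂ (inj₁ (¬ub , uc , bw))) = inj₁ (R-sym q bw , R-sym q uc)
      SwapsTo-sym (inj₂ (inj₂ (¬ub , ¬uc , uw))) =
        inj₂ (inj₂ (¬ub ∘ R-trans q uw , ¬uc ∘ R-trans q uw , R-sym q uw))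

      -- This is why a swap inside a coarser class leaves the coarser levels of a tuple unchanged.
      within : ∀ {l u w} → l ≤ q → R l b c → SwapsTo b c u w → R l u w
      within {l} l≤q bc (inj₁ (ub , cw)) =
        R-trans l (antitone l≤q ub) (R-trans l bc (antitone l≤q cw))
      within {l} l≤q bc (inj₂ (inj₁ (_ , uc , bw))) =
        R-trans l (antitone l≤q uc) (R-trans l (R-sym l bc) (antitone l≤q bw))
      within l≤q bc (inj₂ (inj₂ (_ , _ , uw))) = antitone l≤q uw

      -- Applying `swap` to each entry gives the right `R q`-classes but may destroy the finer
      -- relations, which `transport` restores.
      swap-tuple : ∀ {n} (v : Vec M n) → ∃ λ w →
        (∀ i → SwapsTo b c (lookup v i) (lookup w i)) × Agree (q ≤_) v w
      swap-tuple v =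
        let w , cw , v∼w = transport em q v (map (proj₁ ∘ swap) v) (λ i j → mk⇔
              (λ r → functional r (swapped i) (swapped j))
              (λ r → functional r (SwapsTo-sym (swapped i)) (SwapsTo-sym (swapped j))))
        in w , (λ i → resp (cw i) (swapped i)) , v∼w
        where
        swapped : ∀ i → SwapsTo b c (lookup v i) (lookup (map (proj₁ ∘ swap) v) i)
        swapped i = subst (SwapsTo b c _) (sym (lookup-map i (proj₁ ∘ swap) v))
                      (proj₂ (swap (lookup v i)))
        resp : ∀ {u w w′} → R q w w′ → SwapsTo b c u w → SwapsTo b c u w′
        resp ww′ = Sum.map (λ (p , r) → p , R-trans q r ww′)
          (Sum.map (λ (p , p′ , r) → p , p′ , R-trans q r ww′)
                   (λ (p , p′ , r) → p , p′ , R-trans q r ww′))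

    -- (b c) = (a b)(a c)(a b)
    conjugate : ∀ {a b c} → ¬ R q a b → ¬ R q a c → ¬ R q b c →
      ∀ {u u₁ u₂ w} → SwapsTo b c u w → SwapsTo a b u u₁ → SwapsTo a c u₁ u₂ → SwapsTo a b u₂ w
    conjugate {a} {b} {c} ¬ab ¬ac ¬bc = go
      where
      ¬via : ∀ {u x y} → ¬ R q x y → R q u y → ¬ R q u x
      ¬via ¬xy uy ux = ¬xy (R-trans q (R-sym q ux) uy)
      ¬via′ : ∀ {u x y} → ¬ R q x y → R q u x → ¬ R q u y
      ¬via′ ¬xy ux uy = ¬xy (R-trans q (R-sym q ux) uy)
      go : ∀ {u u₁ u₂ w} → SwapsTo b c u w → SwapsTo a b u u₁ → SwapsTo a c u₁ u₂ → SwapsTo a b u₂ w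
      go (inj₁ (ub , cw)) s t =
        let u₁a = R-sym q (at-right (¬via ¬ab ub) ub s)
            u₂c = R-sym q (at-left u₁a t)
        in inj₂ (inj₂ (¬via ¬ac u₂c , ¬via ¬bc u₂c , R-trans q u₂c cw))
      go (inj₂ (inj₁ (¬ub , uc , bw))) s t =
        let uu₁ = elsewhere (¬via ¬ac uc) ¬ub s
            u₁c = R-trans q (R-sym q uu₁) uc
            u₂a = R-sym q (at-right (¬via ¬ac u₁c) u₁c t)
        in inj₁ (u₂a , bw)
      go {u} (inj₂ (inj₂ (¬ub , ¬uc , uw))) s t with em {R q u a}
      ... | yes ua =
        let u₁b = R-sym q (at-left ua s)
            u₂b = R-trans q (R-sym q (elsewhere (¬via ¬ab u₁b) (¬via′ ¬bc u₁b) t)) u₁b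
        in inj₂ (inj₁ (¬via ¬ab u₂b , u₂b , R-trans q (R-sym q ua) uw))
      ... | no ¬ua =
        let uu₁ = elsewhere ¬ua ¬ub s
            uu₂ = R-trans q uu₁ (elsewhere (¬ua ∘ R-trans q uu₁) (¬uc ∘ R-trans q uu₁) t)
        in inj₂ (inj₂ (¬ua ∘ R-trans q uu₂ , ¬ub ∘ R-trans q uu₂ , R-trans q (R-sym q uu₂) uw))

-- Swaps that preserve a definable set

module _ {a i} (em : ExcludedMiddle (a ⊔ i)) {M : Set a} (C : Chain M) (𝓐 : Family M i)
         {k} {D : Pred (Vec M k) a} (D-definable : Definable 𝓐 D) where
  open Chain C

  private
    emₐ : ExcludedMiddle a
    emₐ = excludedMiddle-lower i em

    𝓡 : Family M 0ℓ
    𝓡 = binaryFamily R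

  R-definable : ∀ l → Definable 𝓡 (pairs (R l))
  R-definable l = atom l (zero ∷ suc zero ∷ []) , λ _ → ⇔-refl

  𝓡-invariant : ∀ {n} {P : Pred (Vec M n) a} → Definable 𝓡 P → Invariant U P
  𝓡-invariant (φ , p) v∼w = from (p _) ∘
    Sat-invariant emₐ 𝓡 φ (All.universal atomic (atoms φ)) v∼w ∘ to (p _)
    where
    atomic : ∀ l → Invariant U (Family.rel 𝓡 l)
    atomic l {x ∷ y ∷ []} {x′ ∷ y′ ∷ []} v∼w = to (at v∼w {l} tt zero (suc zero))

  -- `H` stands for the levels kept so far, and `q` is the coarsest of them.
  module DropLevel
    (D-invariant : Invariant U D)
    (q : ℕ) (H : Pred ℕ 0ℓ) (Hq : H q)
    (q≤H : ∀ {l} → H l → q ≤ l) (H≤height : ∀ {l} → H l → l ≤ height)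
    (H-definable : ∀ {l} → H l → Definable 𝓐 (pairs (R l)))
    where
    open Swap emₐ C q

    -- `SwapsTo` fixes `y` only up to `R q`, so its finer levels are tied to those of `x`. They are
    -- tied only at levels in `H`, because the relation has to be definable from `𝓐`.
    Preserves : Rel M a
    Preserves b c = ∀ x y → (∀ j → SwapsTo b c (lookup x j) (lookup y j)) → Agree H x y → D x → D y

    swaps : ∀ {b c} (x : Vec M k) →
      ∃ λ y → (∀ j → SwapsTo b c (lookup x j) (lookup y j)) × Agree (q ≤_) x y
    swaps = swap-tuple

    -- Used twice: over `𝓐`, to compare with the level that is not definable, and over `𝓡`, to
    -- obtain invariance.
    definable-Preserves : ∀ {j} (𝓕 : Family M j) → Definable 𝓕 D →
      (∀ {l} → H l → Definable 𝓕 (pairs (R l))) → Definable 𝓕 (pairs Preserves)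
    definable-Preserves 𝓕 D-def H-def =
      definable-∀Vec k (λ x v → ∀ y → Body x y v)
      (definable-∀Vec k (λ y u → Body (take k u) y (drop k u))
        (definable-→
          (definable-∀Fin λ j → swapsTo b-var c-var (lookup-var x-sel j) (lookup-var y-sel j))
          (definable-→ (definable-Agree emₐ C 𝓕 H≤height H-def x-sel y-sel)
            (definable-→ (definable-select x-sel D-def) (definable-select y-sel D-def)))))
      where
      open Definability 𝓕
      Body : Vec M k → Vec M k → Vec M 2 → Set a
      Body x y v = (∀ j → SwapsTo (lookup v zero) (lookup v (suc zero)) (lookup x j) (lookup y j)) →
        Agree H x y → D x → D y
      y-sel : Selection {M = M} {k + (k + 2)} (take k)
      y-sel = take-selection k id-selection
      x-sel : Selection {M = M} {k + (k + 2)} (take k ∘ drop k)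
      x-sel = take-selection k (drop-selection k id-selection)
      v-sel : Selection {M = M} {k + (k + 2)} (drop k ∘ drop k)
      v-sel = drop-selection k (drop-selection k id-selection)
      b-var = lookup-var v-sel zero
      c-var = lookup-var v-sel (suc zero)
      swapsTo : ∀ {n} {b c u w : Vec M n → M} → Var b → Var c → Var u → Var w →
        Definable 𝓕 (λ v → SwapsTo (b v) (c v) (u v) (w v))
      swapsTo b c u w = definable-⊎ (definable-× (r u b) (r c w)) (definable-⊎
          (definable-× (definable-¬ (r u b)) (definable-× (r u c) (r b w)))
          (definable-× (definable-¬ (r u b)) (definable-× (definable-¬ (r u c)) (r u w))))
        where
        r : ∀ {f g : Vec M _ → M} → Var f → Var g → Definable 𝓕 (λ v → R q (f v) (g v))
        r = definable-pairs (R q) (H-def Hq)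

    Preserves-invariant : Invariant U (pairs Preserves)
    Preserves-invariant = 𝓡-invariant (definable-Preserves 𝓡
      (definable-Invariant emₐ C 𝓡 id (λ {l} _ → R-definable l) (D-invariant ∘ Agree-finest emₐ C))
      (λ {l} _ → R-definable l))

    -- By refinement, the level at which a pair separates determines its relation at every level, so
    -- the two pairs agree on `U`.
    Preserves-gap : ∀ {l b c b′ c′} → R l b c → ¬ R (suc l) b c → R l b′ c′ → ¬ R (suc l) b′ c′ →
      Preserves b c → Preserves b′ c′
    Preserves-gap {l} {b} {c} {b′} {c′} r ¬r r′ ¬r′ =
      Preserves-invariant {b ∷ c ∷ []} {b′ ∷ c′ ∷ []} (Agree-∷ (agree λ { _ zero zero →
        mk⇔ (λ _ → R-refl _) (λ _ → R-refl _) }) λ { {m} _ zero → pattern-at m })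
      where
      pattern-at : ∀ m → R m b c ⇔ R m b′ c′
      pattern-at m with m ℕ.≤? l
      ... | yes m≤l = mk⇔ (λ _ → antitone m≤l r′) (λ _ → antitone m≤l r)
      ... | no m≰l  = mk⇔ (⊥-elim ∘ ¬r ∘ antitone (ℕ.≰⇒> m≰l)) (⊥-elim ∘ ¬r′ ∘ antitone (ℕ.≰⇒> m≰l))

    module _ {p} (p<q : suc p ≤ q)
             (D-inv : Invariant (λ l → l < suc (suc p) ⊎ H l) D)
             (¬definable : ¬ Definable 𝓐 (pairs (R (suc p)))) where

      Low : Pred ℕ 0ℓ
      Low l = l < suc p ⊎ H l

      -- Such a swap keeps every entry in its `R (suc p)`-class, and agreement on `H` is part of
      -- `Preserves`.
      fine-preserves : ∀ {b c} → R (suc p) b c → Preserves b c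
      fine-preserves {b} {c} bc x y xy x∼y = D-inv (agree λ
        { (inj₁ (s≤s l≤p)) i j → R-cong _ (close l≤p i) (close l≤p j)
        ; (inj₂ h) → at x∼y h })
        where
        close : ∀ {l} → l ≤ suc p → ∀ i → R l (lookup x i) (lookup y i)
        close l≤p i = antitone l≤p (within p<q bc (xy i))

      -- Otherwise `Preserves` would coincide with `R (suc p)` and define it from `𝓐`.
      preserves-coarser : ∃ λ b → ∃ λ c → Preserves b c × ¬ R (suc p) b c
      preserves-coarser with emₐ {∃ λ b → ∃ λ c → Preserves b c × ¬ R (suc p) b c}
      ... | yes found = found
      ... | no ¬found = ⊥-elim (¬definable (Definability.definable-resp-⇔ 𝓐
              (λ v → mk⇔ coarser fine-preserves) (definable-Preserves 𝓐 D-definable H-definable)))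
        where
        coarser : ∀ {b c} → Preserves b c → R (suc p) b c
        coarser {b} {c} pres with emₐ {R (suc p) b c}
        ... | yes r = r
        ... | no ¬r = ⊥-elim (¬found (b , c , pres , ¬r))

      -- By `conjugate`, swapping `b` and `c` amounts to three swaps that involve `d`; they lead
      -- from `x` through `x₁` and `x₂` to `y`.
      Preserves-trans : ∀ {b c d} → ¬ R q d b → ¬ R q d c → ¬ R q b c →
        Preserves d b → Preserves d c → Preserves b c
      Preserves-trans ¬db ¬dc ¬bc pb pc x y xy x∼y Dx =
        let x₁ , xx₁ , x∼x₁ = swaps x
            x₂ , xx₂ , x₁∼x₂ = swaps x₁
        in pb x₂ y (λ j → conjugate ¬db ¬dc ¬bc (xy j) (xx₁ j) (xx₂ j))
             (Agree-trans (Agree-sym (Agree-⊆ q≤H (Agree-trans x∼x₁ x₁∼x₂))) x∼y)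
             (pc x₁ x₂ xx₂ (Agree-⊆ q≤H x₁∼x₂) (pb x x₁ xx₁ (Agree-⊆ q≤H x∼x₁) Dx))

      -- Some preserving pair separates at a level `l` with `l ≤ p`. By `Preserves-gap`, every pair
      -- that separates there is preserving.
      coarse-preserves : ∀ {b c} → R p b c → Preserves b c
      coarse-preserves {b} {c} bc with emₐ {R (suc p) b c}
      ... | yes r = fine-preserves r
      ... | no ¬r with preserves-coarser
      ... | b₀ , c₀ , pres , ¬r₀ with first-gap emₐ C (suc p) ¬r₀
      ... | l , l<p , gap , ¬gap with emₐ {R (suc l) b c}
      ... | no ¬bc = Preserves-gap gap ¬gap (antitone (ℕ.≤-pred l<p) bc) ¬bc pres
      -- The pair `b`, `c` separates later than `l`, but a suitable `d` separates from both exactly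
      -- at `l`.
      ... | yes bc′ with gap-everywhere emₐ C gap ¬gap b
      ... | d , bd , ¬bd = Preserves-trans
              (¬db ∘ antitone l<q) (¬dc ∘ antitone l<q) (¬r ∘ antitone p<q)
              (Preserves-gap gap ¬gap (R-sym l bd) ¬db pres)
              (Preserves-gap gap ¬gap (R-trans l (R-sym l bd) (refines l bc′)) ¬dc pres)
        where
        l<q : suc l ≤ q
        l<q = ℕ.≤-trans l<p p<q
        ¬db : ¬ R (suc l) d b
        ¬db = ¬bd ∘ R-sym (suc l)
        ¬dc : ¬ R (suc l) d c
        ¬dc dc = ¬db (R-trans (suc l) dc (R-sym (suc l) bc′))

      module _ {y : Vec M k} where

        RowsAgree : Vec M k → Fin k → Fin k → Set a
        RowsAgree z i j = R (suc p) (lookup z i) (lookup z j) ⇔ R (suc p) (lookup y i) (lookup y j)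

        -- The invariant of the induction: `z` stays in `D` and agrees with `y` on `Low`, and its
        -- first `n` entries also have the right pattern at level `suc p`.
        Aligned : ℕ → Vec M k → Set a
        Aligned n z = D z × Agree Low z y × (∀ i j → toℕ i < n → toℕ j < n → RowsAgree z i j)

        align-next : ∀ {n z} → Aligned n z → ∀ i → toℕ i ≡ n →
          ∃ λ z′ → Aligned n z′ × (∀ j → toℕ j < n → RowsAgree z′ i j)
        align-next {n} {z} (Dz , z∼y , prefix) i refl
          with emₐ {∃ λ j → toℕ j < n × R q (lookup y i) (lookup y j)}
        -- Entry `i` shares its `R q`-class with the earlier entry `e`, in `y` and in `z` alike, so
        -- its row is already right.
        ... | yes (e , e<n , yie) = z , (Dz , z∼y , prefix) , λ j j<n →
              ⇔-trans (R-cong (suc p) (antitone p<q (from (at z∼y (inj₂ Hq) i e) yie)) (R-refl _))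
                (⇔-trans (prefix e j e<n j<n)
                  (R-cong (suc p) (R-sym _ (antitone p<q yie)) (R-refl _)))
        ... | no fresh
          -- First an `R (suc p)`-class inside the `R p`-class of entry `i` of `z`, related to the
          -- earlier entries as `y` demands.
          with t′ , zt′ , row′ ← one-point emₐ (isEquivalence p) (isEquivalence (suc p)) (refines p)
                 (uniform p) (λ j → toℕ j < n) {lookup y} {lookup z} {lookup y i} {lookup z i}
                 (λ {j} {j′} j<n j′<n → ⇔-sym (prefix j j′ j<n j′<n))
                 (λ {j} _ → ⇔-sym (at z∼y (inj₁ ℕ.≤-refl) i j))
          -- Then, inside it, an `R q`-class without earlier entries of `z`. Swapping it with the
          -- class of entry `i` leaves the earlier entries in their `R q`-classes.
          with t , t′t , row ← one-point emₐ (isEquivalence (suc p)) (isEquivalence q) (antitone p<q)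
                 (uniform-≤ emₐ p<q) (λ j → toℕ j < n) {lookup y} {lookup z} {lookup y i} {t′}
                 (λ {j} {j′} _ _ → ⇔-sym (at z∼y (inj₂ Hq) j j′)) (λ {j} → row′ {j})
          with z′ , zz′ , z∼z′ ← swaps {lookup z i} {t} z
          = z′ , (D-z′ , Agree-trans (Agree-sym low) z∼y , prefix′) , row-z′
          where
          zt : R p (lookup z i) t
          zt = R-trans p zt′ (refines p t′t)
          D-z′ : D z′
          D-z′ = coarse-preserves zt z z′ zz′ (Agree-⊆ q≤H z∼z′) Dz
          low : Agree Low z z′
          low = agree λ
            { (inj₁ (s≤s l≤p)) j j′ → R-cong _ (close l≤p j) (close l≤p j′)
            ; (inj₂ h) → at z∼z′ (q≤H h) }
            where
            close : ∀ {l} → l ≤ p → ∀ j → R l (lookup z j) (lookup z′ j)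
            close l≤p j = within (ℕ.≤-trans l≤p (ℕ.<⇒≤ p<q)) (antitone l≤p zt) (zz′ j)
          unmoved : ∀ {j} → toℕ j < n → R (suc p) (lookup z j) (lookup z′ j)
          unmoved {j} j<n = antitone p<q (elsewhere
            (λ r → fresh (j , j<n , to (at z∼y (inj₂ Hq) i j) (R-sym q r)))
            (λ r → fresh (j , j<n , from (row j<n) (R-sym q r))) (zz′ j))
          prefix′ : ∀ j j′ → toℕ j < n → toℕ j′ < n → RowsAgree z′ j j′
          prefix′ j j′ j<n j′<n = ⇔-trans (⇔-sym (R-cong (suc p) (unmoved j<n) (unmoved j′<n)))
            (prefix j j′ j<n j′<n)
          row-z′ : ∀ j → toℕ j < n → RowsAgree z′ i j
          row-z′ j j<n = ⇔-trans (R-cong (suc p)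
              (R-sym _ (R-trans _ t′t (antitone p<q (at-left (R-refl q) (zz′ i)))))
              (R-sym _ (unmoved j<n)))
            (⇔-sym (row′ j<n))

        align : ∀ {x} → D x → Agree Low x y → ∀ n → n ≤ k → ∃ (Aligned n)
        align {x} Dx x∼y zero    _   = x , Dx , x∼y , λ _ _ ()
        align {x} Dx x∼y (suc n) n<k
          with z , aligned ← align Dx x∼y n (ℕ.<⇒≤ n<k)
          with z′ , (Dz′ , z′∼y , prefix) , row ← align-next aligned (fromℕ< n<k) (toℕ-fromℕ< n<k)
          = z′ , Dz′ , z′∼y , λ i j i≤n j≤n → extended i j (last i i≤n) (last j j≤n)
          where
          last : ∀ i → toℕ i < suc n → toℕ i < n ⊎ i ≡ fromℕ< n<k
          last i (s≤s i≤n) = Sum.map₂ (λ e → toℕ-injective (trans e (sym (toℕ-fromℕ< n<k))))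
            (ℕ.m≤n⇒m<n∨m≡n i≤n)
          extended : ∀ i j → toℕ i < n ⊎ i ≡ fromℕ< n<k → toℕ j < n ⊎ j ≡ fromℕ< n<k →
            RowsAgree z′ i j
          extended i j (inj₁ i<n)  (inj₁ j<n)  = prefix i j i<n j<n
          extended i j (inj₁ i<n)  (inj₂ refl) = mk⇔
            (R-sym _ ∘ to (row i i<n) ∘ R-sym _) (R-sym _ ∘ from (row i i<n) ∘ R-sym _)
          extended i j (inj₂ refl) (inj₁ j<n)  = row j j<n
          extended i j (inj₂ refl) (inj₂ refl) = mk⇔ (λ _ → R-refl _) (λ _ → R-refl _)

      -- Aligning all `k` entries gives a member of `D` that agrees with `y` at level `suc p` too,
      -- and then `D-inv` applies.
      drop-level : Invariant Low D
      drop-level {x} {y} x∼y Dx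
        with z , Dz , z∼y , rows ← align Dx x∼y k ℕ.≤-refl
        = D-inv (agree level) Dz
        where
        level : ∀ {l} → l < suc (suc p) ⊎ H l → ∀ i j → _
        level (inj₂ h) i j = at z∼y (inj₂ h) i j
        level (inj₁ (s≤s l≤p)) i j with ℕ.m≤n⇒m<n∨m≡n l≤p
        ... | inj₁ l<p  = at z∼y (inj₁ l<p) i j
        ... | inj₂ refl = rows i j (toℕ<n i) (toℕ<n j)

  -- Passing through the decision `em` gives a predicate in `Set`, whatever the universes of `M` and
  -- `𝓐`.
  DefinableLevel : Pred ℕ 0ℓ
  DefinableLevel l = l ≤ height × True (em {Definable 𝓐 (pairs (R l))})

  invariant-definableLevels : Invariant U D → Invariant DefinableLevel D
  invariant-definableLevels D-invariant = descend height height ℕ.≤-refl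
    equality (D-invariant ∘ Agree-finest emₐ C ∘ Agree-⊆ top)
    where
    High : ℕ → Pred ℕ 0ℓ
    High q l = q ≤ l × DefinableLevel l
    equality : DefinableLevel height
    equality = ℕ.≤-refl , fromWitness
      (Definability.definable-resp-⇔ 𝓐 (λ _ → ⇔-sym height-⇔) (Definability.definable-≡ 𝓐))
    top : ∀ {l} → l ≤ height → l < height ⊎ High height l
    top l≤h = Sum.map₂ (λ { refl → ℕ.≤-refl , equality }) (ℕ.m≤n⇒m<n∨m≡n l≤h)
    -- The levels below `p` are still to be examined; those from `p` up to but excluding `q` have
    -- been dropped.
    descend : ∀ p q → p ≤ q → DefinableLevel q → Invariant (λ l → l < p ⊎ High q l) D →
      Invariant DefinableLevel D
    descend zero    q p≤q Jq inv = inv ∘ Agree-⊆ λ { (inj₁ ()) ; (inj₂ (_ , Jl)) → Jl }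
    descend (suc p) q p<q Jq inv with em {Definable 𝓐 (pairs (R p))}
    descend (suc p) q p<q Jq inv | yes def = descend p p ℕ.≤-refl Jp (inv ∘ Agree-⊆ λ
      { (inj₁ (s≤s l≤p)) → Sum.map₂ (λ { refl → ℕ.≤-refl , Jp }) (ℕ.m≤n⇒m<n∨m≡n l≤p)
      ; (inj₂ (q≤l , Jl)) → inj₂ (ℕ.≤-trans (ℕ.<⇒≤ p<q) q≤l , Jl) })
      where
      Jp : DefinableLevel p
      Jp = ℕ.≤-trans (ℕ.<⇒≤ p<q) (proj₁ Jq) , fromWitness def
    -- Level 0 is total and hence definable, so it is never dropped.
    descend (suc zero) q p<q Jq inv | no ¬def =
      ⊥-elim (¬def (Definability.definable-full 𝓐 λ _ → coarsest _ _))
    descend (suc (suc p)) q p<q Jq inv | no ¬def = descend (suc p) q (ℕ.<⇒≤ p<q) Jq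
      (DropLevel.drop-level D-invariant q (High q) (ℕ.≤-refl , Jq) proj₁ (proj₁ ∘ proj₂)
        (λ { (_ , _ , w) → toWitness w }) (ℕ.<⇒≤ p<q) inv ¬def)

-- Models of REF

module _ {a} {M : Set a} where

  truncate : (ℕ → Rel M a) → ℕ → ℕ → Rel M a
  truncate E zero    l       = _≡_
  truncate E (suc N) zero    = E zero
  truncate E (suc N) (suc l) = truncate (E ∘ suc) N l

  truncate-< : ∀ (E : ℕ → Rel M a) {N l} → l < N → truncate E N l ≡ E l
  truncate-< E {suc N} {zero}  _         = refl
  truncate-< E {suc N} {suc l} (s≤s l<N) = truncate-< (E ∘ suc) l<N

  truncate-≥ : ∀ (E : ℕ → Rel M a) {N l} → N ≤ l → truncate E N l ≡ _≡_
  truncate-≥ E z≤n       = refl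
  truncate-≥ E (s≤s N≤l) = truncate-≥ (E ∘ suc) N≤l

  truncate-isEquivalence : ∀ {E : ℕ → Rel M a} → (∀ l → IsEquivalence (E l)) →
    ∀ N l → IsEquivalence (truncate E N l)
  truncate-isEquivalence eq zero    l       = ≡.isEquivalence
  truncate-isEquivalence eq (suc N) zero    = eq zero
  truncate-isEquivalence eq (suc N) (suc l) = truncate-isEquivalence (eq ∘ suc) N l

  truncate-refines : ∀ {E : ℕ → Rel M a} → (∀ l → IsEquivalence (E l)) → (∀ l → E (suc l) ⇒ E l) →
    ∀ N l → truncate E N (suc l) ⇒ truncate E N l
  truncate-refines eq ref zero          l       = id
  truncate-refines eq ref (suc zero)    zero    = IsEquivalence.reflexive (eq zero)
  truncate-refines eq ref (suc (suc N)) zero    = ref zero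
  truncate-refines eq ref (suc N)       (suc l) = truncate-refines (eq ∘ suc) (λ m → ref (suc m)) N l

  truncate-uniform : ∀ {E : ℕ → Rel M a} → (∀ l → Uniform (E l) (E (suc l))) →
    (∀ l x k → HasReps (E l) _≡_ k x) → ∀ N l → Uniform (truncate E N l) (truncate E N (suc l))
  -- Classes of equality are singletons, so any two indices coincide and a constant function will
  -- do.
  truncate-uniform uni inf zero          l {y = y} (f , xf , f-inj) =
    (λ _ → y) , (λ _ → refl) , λ {i} {j} _ → f-inj (trans (sym (xf i)) (xf j))
  -- Between the last proper level and equality, uniformity holds because every class is infinite.
  truncate-uniform uni inf (suc zero)    zero {k} {y = y} _ = inf zero y k
  truncate-uniform uni inf (suc (suc N)) zero    = uni zero
  truncate-uniform uni inf (suc N)       (suc l) =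
    truncate-uniform (λ m → uni (suc m)) (inf ∘ suc) N l

module _ {a} (em : ExcludedMiddle a) {M : Set a} {E : ℕ → Rel M a} (ref : IsREF E) where
  open IsREF ref

  -- In the finite case the `k` representatives go injectively to the `m` classes around `x`, so
  -- `k ≤ m`, and the class of `y` has `m` representatives.
  splits⇒uniform : ∀ n → Uniform (E n) (E (suc n))
  splits⇒uniform n {k} {x} {y} (f , xf , f-inj) with δ n | splits n x | splits n y
  ... | infinite   | _                | reps-y           = reps-y k
  ... | finite m _ | (g , _ , covers) | (h , reps-y , _) =
    HasReps-≤ (E n) (E (suc n)) k≤m (h , reps-y)
    where
    k≤m : k ≤ m
    k≤m = injective⇒≤ {f = λ i → proj₁ (covers (f i) (xf i))} λ {i} {j} e → f-inj
      (Eq.trans (Eq.sym (proj₂ (covers (f i) (xf i))))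
        (subst (λ s → E (suc n) (g s) (f j)) (sym e) (proj₂ (covers (f j) (xf j)))))
      where module Eq = IsEquivalence (isEquivalence (suc n))

  splits⇒gap : ∀ n x → ∃ λ y → E n x y × ¬ E (suc n) x y
  splits⇒gap n x with δ n | splits n x
  ... | infinite     | reps         = reps⇒gap em (E n) (isEquivalence (suc n)) (reps 2)
  ... | finite m 2≤m | (g , r , _)  =
    reps⇒gap em (E n) (isEquivalence (suc n)) (HasReps-≤ (E n) (E (suc n)) 2≤m (g , r))

  -- A point `y` split off from `x` at the next level lies outside the `E (suc n)`-class of `x`,
  -- where the induction finds the other `k` points.
  classes-infinite : ∀ n x k → HasReps (E n) _≡_ k x
  classes-infinite n x zero    = (λ ()) , (λ ()) , λ {}
  classes-infinite n x (suc k)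
    with y , xy , ¬xy ← splits⇒gap n x
    with f , xf , f-inj ← classes-infinite (suc n) x k
    = (λ { zero → y ; (suc i) → f i }) , (λ { zero → xy ; (suc i) → refines n (xf i) }) ,
      λ { {zero}  {zero}  _ → refl
        ; {zero}  {suc j} e → ⊥-elim (¬xy (subst (E (suc n) x) (sym e) (xf j)))
        ; {suc i} {zero}  e → ⊥-elim (¬xy (subst (E (suc n) x) e (xf i)))
        ; {suc i} {suc j} e → cong suc (f-inj e) }

  -- The number of `E 0`-classes is arbitrary. Above the single class of the total relation it needs
  -- no comparison between classes.
  withTotal : ℕ → Rel M a
  withTotal zero    = λ _ _ → ⊤ₚ
  withTotal (suc n) = E n

  -- Level 0 is total, levels 1 to `N` are the first `N` relations of `E`, and equality begins at
  -- level `suc N`.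
  truncatedChain : ℕ → Chain M
  truncatedChain N = record
    { R             = truncate withTotal (suc N)
    ; height        = suc N
    ; isEquivalence = truncate-isEquivalence eq (suc N)
    ; refines       = truncate-refines eq (λ { zero _ → ttₚ ; (suc n) → refines n }) (suc N)
    ; coarsest      = λ _ _ → ttₚ
    ; finest        = λ N≤l {x} {y} → subst (λ S → S x y) (truncate-≥ withTotal N≤l)
    ; uniform       = truncate-uniform
        (λ { zero {k} {x} {y} (f , _ , f-inj) → f , (λ _ → ttₚ) , f-inj ; (suc n) → splits⇒uniform n })
        (λ { zero x k → let f , _ , f-inj = classes-infinite 0 x k in f , (λ _ → ttₚ) , f-inj
           ; (suc n) → classes-infinite n })
        (suc N)
    }
    where
    eq : ∀ l → IsEquivalence (withTotal l)
    eq zero    = record { refl = ttₚ ; sym = λ _ → ttₚ ; trans = λ _ _ → ttₚ }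
    eq (suc n) = isEquivalence n

-- Definable equivalence with a set of levels

theoremA3 : ∀ {a i} → ExcludedMiddle (a ⊔ i) →
    {M : Set a} (E : ℕ → Rel M a) → IsREF E →
    (𝓐 : Family M i) → AllDefinable (binaryFamily E) 𝓐 →
    ∃ λ (J : Pred ℕ 0ℓ) → DefinablyEquivalent 𝓐 (subfamily E J)
theoremA3 {a} {i} em {M} E ref 𝓐 𝓐-definable = J , J-definable , 𝓐-definable′
  where
  emₐ : ExcludedMiddle a
  emₐ = excludedMiddle-lower i em

  -- All levels definable from `𝓐` are taken, so `J` does not depend on the member of `𝓐`, whereas
  -- the chain used below does.
  J : Pred ℕ 0ℓ
  J n = True (em {Definable 𝓐 (pairs (E n))})

  J-definable : AllDefinable 𝓐 (subfamily E J)
  J-definable (n , n∈J) =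
    Definability.definable-resp-⇔ 𝓐 (λ { (_ ∷ _ ∷ []) → ⇔-refl }) (toWitness n∈J)

  𝓐-definable′ : AllDefinable (subfamily E J) 𝓐
  𝓐-definable′ s with φ , D⇔φ ← 𝓐-definable s =
    definable-Invariant emₐ C (subfamily E J) proj₁ level
      (invariant-definableLevels em C 𝓐 s-definable D-invariant)
    where
    -- Every `E n` that occurs in `φ` has `n < N` and is thus a level of the chain.
    N = suc (max 0 (atoms φ))
    C = truncatedChain emₐ ref N
    open Chain C

    s-definable : Definable 𝓐 (Family.rel 𝓐 s)
    s-definable = atom s (Vec.allFin _) ,
      λ v → ≡⇒⇔ (cong (Family.rel 𝓐 s) (sym (map-lookup-allFin v)))

    R≡E : ∀ {n} → n < N → R (suc n) ≡ E n
    R≡E n<N = truncate-< (withTotal emₐ ref) (s≤s n<N)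

    D-invariant : Invariant U (Family.rel 𝓐 s)
    D-invariant v∼w = from (D⇔φ _) ∘
      Sat-invariant emₐ (binaryFamily E) φ (All.map atomic (xs≤max 0 (atoms φ))) v∼w ∘ to (D⇔φ _)
      where
      atomic : ∀ {n} → n ≤ max 0 (atoms φ) → Invariant U (Family.rel (binaryFamily E) n)
      atomic {n} n≤m {x ∷ y ∷ []} {x′ ∷ y′ ∷ []} v∼w =
        to (subst (λ S → S x y ⇔ S x′ y′) (R≡E (s≤s n≤m)) (at v∼w {suc n} tt zero (suc zero)))

    -- Besides members of `J`, the definable levels of the chain are the total relation and
    -- equality, which need no atoms.
    level : ∀ {l} → DefinableLevel em C 𝓐 s-definable l → Definable (subfamily E J) (pairs (R l))
    level {zero}  _         = Definability.definable-full (subfamily E J) λ _ → ttₚ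
    level {suc n} (_ , def) with ℕ.<-≤-connex n N
    ... | inj₁ n<N = atom (n , fromWitness (subst (Definable 𝓐 ∘ pairs) (R≡E n<N) (toWitness def)))
                          (zero ∷ suc zero ∷ []) ,
                     λ v → ≡⇒⇔ (cong (λ S → pairs S v) (R≡E n<N))
    ... | inj₂ N≤n = subst (Definable (subfamily E J) ∘ pairs)
                       (sym (truncate-≥ (withTotal emₐ ref) (s≤s N≤n)))
                       (Definability.definable-≡ (subfamily E J))
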